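{- Let $\mathcal J$ be an ideal on $\omega$. (1) The following conditions are equivalent: (a) $\mathcal J$ is extendable to a selective ideal (i.e. $\mathcal J\subseteq\mathcal J'$ for some selective ideal $\mathcal J'$ on $\omega$); (b) $\mathcal{ED}\not\preceq^{\omega_1}_{\omega^\omega,1-1}\mathcal J$; (c) $\mathcal{ED}\not\preceq^{\omega_1}_{\omega^\omega,\mathrm{Fin}-1}\mathcal J$; (d) $\mathcal{ED}\not\preceq^{\omega_1}_{\omega^\omega,\omega^\omega}\mathcal J$. (2) Under CH, the conditions (a), (b), (c), (d) listed in (1) are equivalent to each of the following: (e) there is a selective ultrafilter which is not a $\mathcal J$-point; (f) there is a selective ultrafilter which is not a weak $\mathcal J$-ultrafilter; (g) there is a selective ultrafilter which is not a $\mathcal J$-ultrafilter.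
   Context: An ideal on a set $X$ is a family of subsets of $X$ closed under finite unions and subsets, containing all finite subsets of $X$ and not containing $X$; $\mathcal J^+=\mathcal P(X)\setminus\mathcal J$. Ideals on countably infinite sets are regarded as ideals on $\omega$ via fixed bijections. $\mathcal{ED}=\{A\subseteq\omega\times\omega:\exists m$ such that for all but finitely many $n$, $|\{k:(n,k)\in A\}|<m\}$. $\mathcal J$ is a selective ideal if for every decreasing sequence $(A_n)_{n\in\omega}$ of sets in $\mathcal J^+$ there is $A\in\mathcal J^+$, $A\subseteq A_0$, such that $|A\cap(A_n\setminus A_{n+1})|\le1$ for every $n$. For $\mathcal F\subseteq\omega^\omega$ and ideals $\mathcal I,\mathcal K$ on $\omega$, $\mathcal I\le_{\mathcal F}\mathcal K$ means that there is $f\in\mathcal F$ with $f^{ -1}[B]\in\mathcal K$ for every $B\in\mathcal I$. $\mathrm{Fin}-1$ and $1-1$ denote the families of all finite-to-one, respectively one-to-one, functions $\omega\to\omega$. For an ideal $\mathcal K$ on $\omega$ and $\mathcal A\subseteq\mathcal P(\omega)$, $\mathcal K(\mathcal A)=\{B\subseteq\omega:\exists F\in[\mathcal A]^{<\omega}\ (B\setminus\bigcup F\in\mathcal K)\}$. $\mathcal I\preceq^{\omega_1}_{\mathcal F,\mathcal G}\mathcal J$ means: for each ideal $\mathcal J'$ on $\omega$ with $\mathcal J\le_{\mathcal G}\mathcal J'$ there is a countable $\mathcal A\subseteq\mathcal P(\omega)$ with $\omega\notin\mathcal J'(\mathcal A)$ and $\mathcal I\le_{\mathcal F}\mathcal J'(\mathcal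 A)$. Ultrafilters on $\omega$ contain all cofinite sets; $\mathcal U^*=\{\omega\setminus A:A\in\mathcal U\}$. $\mathcal U$ is a selective (Ramsey) ultrafilter if $\mathcal U^*$ is a selective ideal. $\mathcal U$ is a $\mathcal J$-ultrafilter (weak $\mathcal J$-ultrafilter, $\mathcal J$-point) if $\mathcal J\not\le_{\mathcal F}\mathcal U^*$ for $\mathcal F=\omega^\omega$ ($\mathrm{Fin}-1$, $1-1$, respectively). -}

module Defs where

open import Level using (Level; 0ℓ; _⊔_) renaming (suc to lsuc)
open import Data.Nat using (ℕ; suc; _<_; _≤_)
open import Data.List using (List; length; foldr)
open import Data.List.Membership.Propositional using () renaming (_∈_ to _∈ᴸ_)
open import Data.List.Relation.Unary.All using (All)
open import Data.Product using (Σ-syntax; ∃-syntax; _×_; _,_)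
open import Data.Sum using (_⊎_)
open import Function.Bundles using (Bijection; _↔_; Inverse)
open import Function.Definitions using (Injective)
open import Induction.WellFounded using (WellFounded)
open import Relation.Binary.Core using (Rel)
open import Relation.Binary.Bundles using (Setoid)
open import Relation.Binary.PropositionalEquality using (_≡_; setoid)
open import Relation.Binary.Structures using (IsStrictTotalOrder)
open import Relation.Nullary using (¬_)
open import Relation.Unary using (Pred; _∈_; _∉_; _⊆_; _≐_; _∪_; _∩_; _∖_; ∁; U; ∅; ｛_｝; _⊢_)
open import Relation.Unary.Relation.Binary.Equality using (≐-setoid)

private
  variable
    a ℓ ℓ₁ ℓ₂ : Level

-- Subsets are compared by ≐, never by ≡.
𝒫 : Set → Set₁
𝒫 X = Pred X 0ℓ

-- Under excluded middle every family is equivalent to one with ℓ = 0ℓ, so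
-- quantifying over families at level 0ℓ is quantifying over all of them.  The
-- level varies only because some constructions below land one level up.
Family : Set → (ℓ : Level) → Set (lsuc 0ℓ ⊔ lsuc ℓ)
Family X ℓ = Pred (𝒫 X) ℓ

⋃ᴸ : {X : Set} → List (𝒫 X) → 𝒫 X
⋃ᴸ = foldr _∪_ ∅

-- Cardinality bounds: A is covered by a list of the given length, possibly with
-- repetitions or elements outside A.
∣_∣≤_ : {X : Set} → 𝒫 X → ℕ → Set
∣ A ∣≤ m = ∃[ xs ] (length xs ≤ m × A ⊆ (_∈ᴸ xs))

∣_∣<_ : {X : Set} → 𝒫 X → ℕ → Set
∣ A ∣< m = ∃[ xs ] (length xs < m × A ⊆ (_∈ᴸ xs))

Finite : {X : Set} → 𝒫 X → Set
Finite A = ∃[ xs ] (A ⊆ (_∈ᴸ xs))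

Cofinite : {X : Set} → 𝒫 X → Set
Cofinite A = Finite (∁ A)

-- Finite and empty sets count as countable.  The code need not respect ≈: keeping
-- the least code of each ≈-class gives an injection of the classes into ℕ.
Countable : (S : Setoid a ℓ₁) → Pred (Setoid.Carrier S) ℓ → Set (a ⊔ ℓ₁ ⊔ ℓ)
Countable S P =
  Σ[ code ∈ (Carrier → ℕ) ] (∀ {x y} → x ∈ P → y ∈ P → code x ≡ code y → x ≈ y)
  where open Setoid S

record IsIdeal {X : Set} (𝒥 : Family X ℓ) : Set (lsuc 0ℓ ⊔ ℓ) where
  field
    ∪-closed : ∀ {A B} → A ∈ 𝒥 → B ∈ 𝒥 → A ∪ B ∈ 𝒥
    ⊆-closed : ∀ {A B} → B ⊆ A → A ∈ 𝒥 → B ∈ 𝒥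
    finite   : ∀ {A} → Finite A → A ∈ 𝒥
    proper   : U ∉ 𝒥

_⁺ : {X : Set} → Family X ℓ → Family X ℓ
𝒥 ⁺ = ∁ 𝒥

record IsSelectiveIdeal {X : Set} (𝒥 : Family X ℓ) : Set (lsuc 0ℓ ⊔ ℓ) where
  field
    isIdeal   : IsIdeal 𝒥
    selective : (A : ℕ → 𝒫 X) → (∀ n → A n ∈ 𝒥 ⁺) → (∀ n → A (suc n) ⊆ A n) →
                ∃[ B ] (B ∈ 𝒥 ⁺ × B ⊆ A 0 × (∀ n → ∣ B ∩ (A n ∖ A (suc n)) ∣≤ 1))

ExtendableToSelective : Family ℕ 0ℓ → Set₁
ExtendableToSelective 𝒥 =
  Σ[ 𝒥′ ∈ Family ℕ 0ℓ ] (IsSelectiveIdeal 𝒥′ × 𝒥 ⊆ 𝒥′)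

ED₂ : Family (ℕ × ℕ) 0ℓ
ED₂ A = ∃[ m ] Cofinite (λ n → ∣ (λ k → (n , k) ∈ A) ∣< m)

ED : (ℕ × ℕ) ↔ ℕ → Family ℕ 0ℓ
ED β A = (Inverse.to β ⊢ A) ∈ ED₂

FunctionClass : Set₁
FunctionClass = Pred (ℕ → ℕ) 0ℓ

AllFunctions Fin-1 1-1 : FunctionClass
AllFunctions = U
Fin-1 f      = ∀ n → Finite (f ⊢ ｛ n ｝)
1-1 f        = Injective _≡_ _≡_ f

_≤[_]_ : Family ℕ ℓ₁ → FunctionClass → Family ℕ ℓ₂ → Set (lsuc 0ℓ ⊔ ℓ₁ ⊔ ℓ₂)
ℐ ≤[ ℱ ] 𝒦 = ∃[ f ] (f ∈ ℱ × (∀ B → B ∈ ℐ → (f ⊢ B) ∈ 𝒦))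

_⟨_⟩ : Family ℕ ℓ₁ → Family ℕ ℓ₂ → Family ℕ (lsuc 0ℓ ⊔ ℓ₁ ⊔ ℓ₂)
(𝒦 ⟨ 𝒜 ⟩) B = ∃[ F ] (All (_∈ 𝒜) F × (B ∖ ⋃ᴸ F) ∈ 𝒦)

_≼ω₁[_,_]_ : Family ℕ 0ℓ → FunctionClass → FunctionClass → Family ℕ 0ℓ → Set₁
ℐ ≼ω₁[ ℱ , 𝒢 ] 𝒥 =
  (𝒥′ : Family ℕ 0ℓ) → IsIdeal 𝒥′ → 𝒥 ≤[ 𝒢 ] 𝒥′ →
  Σ[ 𝒜 ∈ Family ℕ 0ℓ ]
    (Countable (≐-setoid ℕ 0ℓ) 𝒜 × U ∉ 𝒥′ ⟨ 𝒜 ⟩ × ℐ ≤[ ℱ ] (𝒥′ ⟨ 𝒜 ⟩))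

record IsUltrafilter (𝒰 : Family ℕ ℓ) : Set (lsuc 0ℓ ⊔ ℓ) where
  field
    ∩-closed : ∀ {A B} → A ∈ 𝒰 → B ∈ 𝒰 → A ∩ B ∈ 𝒰
    ⊆-closed : ∀ {A B} → A ⊆ B → A ∈ 𝒰 → B ∈ 𝒰
    proper   : ∅ ∉ 𝒰
    ultra    : ∀ A → A ∈ 𝒰 ⊎ ∁ A ∈ 𝒰
    cofinite : ∀ {A} → Cofinite A → A ∈ 𝒰

_* : Family ℕ ℓ → Family ℕ (lsuc 0ℓ ⊔ ℓ)
(𝒰 *) B = ∃[ A ] (A ∈ 𝒰 × B ≐ ∁ A)

IsSelectiveUltrafilter : Family ℕ ℓ → Set (lsuc 0ℓ ⊔ ℓ)
IsSelectiveUltrafilter 𝒰 = IsUltrafilter 𝒰 × IsSelectiveIdeal (𝒰 *)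

-- IsPointFor 𝒥 𝒰 reads "𝒰 is a 𝒥-point", and likewise for the other two.
IsUltrafilterFor IsWeakUltrafilterFor IsPointFor :
  Family ℕ 0ℓ → Family ℕ 0ℓ → Set₁
IsUltrafilterFor     𝒥 𝒰 = ¬ (𝒥 ≤[ AllFunctions ] (𝒰 *))
IsWeakUltrafilterFor 𝒥 𝒰 = ¬ (𝒥 ≤[ Fin-1 ] (𝒰 *))
IsPointFor           𝒥 𝒰 = ¬ (𝒥 ≤[ 1-1 ] (𝒰 *))

SomeSelectiveUltrafilterIsNot : Pred (Family ℕ 0ℓ) (lsuc 0ℓ) → Set₁
SomeSelectiveUltrafilterIsNot P =
  Σ[ 𝒰 ∈ Family ℕ 0ℓ ] (IsSelectiveUltrafilter 𝒰 × 𝒰 ∉ P)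

-- ω₁ is the least uncountable ordinal, i.e. an uncountable well-order all of
-- whose proper initial segments are countable.
record IsOmega₁ {W : Set} (_<ʷ_ : Rel W 0ℓ) : Set where
  field
    isStrictTotalOrder : IsStrictTotalOrder _≡_ _<ʷ_
    wellFounded        : WellFounded _<ʷ_
    uncountable        : ¬ Countable (setoid W) U
    segmentsCountable  : ∀ w → Countable (setoid W) (_<ʷ w)

-- 2^ℵ₀ = ℵ₁, with P(ω) as a setoid under ≐.
CH : Set₁
CH = Σ[ W ∈ Set ] Σ[ _<ʷ_ ∈ Rel W 0ℓ ]
       (IsOmega₁ _<ʷ_ × Bijection (setoid W) (≐-setoid ℕ 0ℓ))

{-# OPTIONS --safe #-}
module Submission where

-- Call a set positive when it lies outside the ideal at hand.  The proof of the
-- first part rests on an internal characterisation: an ideal 𝒦 is selective if and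
-- only if ED is not below 𝒦 ⟨ 𝒜 ⟩, via any function, for any countable 𝒜 that
-- leaves 𝒦 ⟨ 𝒜 ⟩ proper.
--
-- If 𝒦 is selective, diagonalising the complements of the finite unions from 𝒜
-- gives a positive B almost disjoint from every member of 𝒜 (almost-disjoint), so
-- that 𝒦 and 𝒦 ⟨ 𝒜 ⟩ have the same members below B.  Suppose that f puts ED
-- below 𝒦 ⟨ 𝒜 ⟩.  Finitely many columns of f then meet B in a member of 𝒦, so B
-- has a positive subset C with at most one point in each column of f.  But then
-- f[C] is in ED and C is inside its preimage (selective⇒¬≤ED).  Conversely,
-- let a decreasing sequence A of positive sets have no positive selector and let
-- 𝒜 consist of the complements of the A n.  Then 𝒦 ⟨ 𝒜 ⟩ is proper
-- (chain-proper), contains every layer A n ∖ A (suc n) and, as finite unions of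
-- selectors, every set with boundedly many points in each layer.  Sending a point
-- x of the n-th layer to (n , x), up to a shift of n, puts ED below 𝒦 ⟨ 𝒜 ⟩
-- (¬ED≤⟨⟩⇒selective).
--
-- Hence the failure of ED ≼ 𝒥 yields a selective 𝒥′ and g with 𝒥 below 𝒥′ via
-- g, and the family of all A whose preimage under g is in 𝒥′ is a selective ideal
-- extending 𝒥 (pushforward-selective).  In the other direction g is the identity,
-- which belongs to each of the three classes of functions.
--
-- For the second part, the dual ideal of a selective ultrafilter can be pushed
-- forward in the same way.  Conversely, if 𝒦 is selective, then every countable
-- almost-inclusion chain of positive sets has a positive pseudo-intersection
-- (pseudo-intersection), and, given a decreasing sequence, every positive set has
-- a positive subset that either misses a term of the sequence or is a selector
-- for it (settling).  Under CH all sequences of sets are listed in type ω₁, and a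
-- recursion of that length produces an almost decreasing tower of positive sets
-- settling all of them.  The tower generates a selective ultrafilter disjoint
-- from 𝒦.

open import Level using (Level; 0ℓ; Lift; lift; lower) renaming (suc to lsuc)
open import Axiom.ExcludedMiddle using (ExcludedMiddle)
open import Data.Nat using (ℕ; zero; suc; _≤_; _<_; z≤n; s≤s; _<?_)
open import Data.Nat.Properties using (≤-reflexive; ≤-total; ≤-pred; <-cmp; <⇒≤; <⇒≱; m≤n⇒m≤1+n; 0≢1+n)
open import Data.List using (List; []; _∷_; _++_; length; map; take; drop; upTo)
open import Data.List.Membership.Propositional using () renaming (_∈_ to _∈ᴸ_)
open import Data.List.Membership.Propositional.Properties using (∈-++⁺ˡ; ∈-++⁺ʳ; ∈-map⁺; ∈-upTo⁺)
open import Data.List.Properties using (length-map)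
open import Data.List.Relation.Unary.All using (All; []; _∷_)
open import Data.List.Relation.Unary.All.Properties using () renaming (++⁺ to All-++⁺)
open import Data.List.Relation.Unary.Any using (here; there)
open import Data.Product using (Σ-syntax; ∃; ∃-syntax; _×_; _,_; proj₁; proj₂)
open import Data.Sum using (_⊎_; inj₁; inj₂; [_,_]′)
open import Data.Empty using (⊥-elim)
open import Data.Unit using (tt)
open import Function using (id; _∘_)
open import Function.Bundles using (_⇔_; mk⇔; _↔_; Bijection; Inverse)
open import Induction.WellFounded using (WellFounded; WfRec; module All; module FixPoint)
open import Relation.Binary.Core using (Rel)
open import Relation.Binary.Definitions using (Trichotomous; tri<; tri≈; tri>)
open import Relation.Binary.PropositionalEquality using (_≡_; _≢_; refl; sym; trans; cong; subst; setoid)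
open import Relation.Binary.Structures using (IsStrictTotalOrder)
open import Relation.Nullary using (¬_; yes; no)
open import Relation.Nullary.Decidable using (decidable-stable)
open import Relation.Unary using (Pred; _∈_; _∉_; _⊆_; _≐_; _∪_; _∩_; _∖_; ∁; U; ∅; _⊢_)
open import Relation.Unary.Relation.Binary.Equality using (≐-setoid)
open import Defs

private
  variable
    ℓ ℓ₁ ℓ₂ : Level
    X : Set

-- Finite sets, almost inclusion and selectors

Finite-⊆ : {A B : 𝒫 X} → A ⊆ B → Finite B → Finite A
Finite-⊆ A⊆B (xs , B⊆xs) = xs , λ x∈A → B⊆xs (A⊆B x∈A)

Finite-∪ : {A B : 𝒫 X} → Finite A → Finite B → Finite (A ∪ B)
Finite-∪ (xs , A⊆xs) (ys , B⊆ys) =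
  xs ++ ys , λ { (inj₁ x∈A) → ∈-++⁺ˡ (A⊆xs x∈A) ; (inj₂ x∈B) → ∈-++⁺ʳ xs (B⊆ys x∈B) }

Finite-∅ : {A : 𝒫 X} → (∀ {x} → x ∉ A) → Finite A
Finite-∅ empty = [] , λ x∈A → ⊥-elim (empty x∈A)

∣∣≤⇒Finite : {A : 𝒫 X} {m : ℕ} → ∣ A ∣≤ m → Finite A
∣∣≤⇒Finite (xs , _ , A⊆xs) = xs , A⊆xs

infix 4 _⊆*_

-- Inclusion modulo a finite set.
_⊆*_ : 𝒫 X → 𝒫 X → Set
A ⊆* B = Finite (A ∖ B)

⊆⇒⊆* : {A B : 𝒫 X} → A ⊆ B → A ⊆* B
⊆⇒⊆* A⊆B = Finite-∅ λ (x∈A , x∉B) → x∉B (A⊆B x∈A)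

Decreasing : (ℕ → 𝒫 X) → Set
Decreasing A = ∀ n → A (suc n) ⊆ A n

Decreasing⇒antitone : {A : ℕ → 𝒫 X} → Decreasing A → ∀ {m n} → m ≤ n → A n ⊆ A m
Decreasing⇒antitone {A = A} dec {n = n} z≤n = from-zero n
  where
  from-zero : ∀ n → A n ⊆ A 0
  from-zero zero    x∈ = x∈
  from-zero (suc n) x∈ = from-zero n (dec n x∈)
Decreasing⇒antitone {A = A} dec (s≤s m≤n) = Decreasing⇒antitone {A = A ∘ suc} (dec ∘ suc) m≤n

-- The layers of a decreasing sequence A are the sets A n ∖ A (suc n); a selector
-- is a subset of A 0 with at most one point in each layer.
IsSelector : (ℕ → 𝒫 X) → 𝒫 X → Set
IsSelector A B = B ⊆ A 0 × (∀ n → ∣ B ∩ (A n ∖ A (suc n)) ∣≤ 1)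

-- The index of the layer containing a point is unique.
layer-unique : {A : ℕ → 𝒫 X} → Decreasing A → ∀ {m n x} →
               x ∈ A m ∖ A (suc m) → x ∈ A n ∖ A (suc n) → m ≡ n
layer-unique {A = A} dec {m} {n} (x∈Am , x∉A1+m) (x∈An , x∉A1+n) with <-cmp m n
... | tri< m<n _ _ = ⊥-elim (x∉A1+m (Decreasing⇒antitone {A = A} dec m<n x∈An))
... | tri≈ _ m≡n _ = m≡n
... | tri> _ _ n<m = ⊥-elim (x∉A1+n (Decreasing⇒antitone {A = A} dec n<m x∈Am))

-- The family of sets equal, as sets, to some B i with i in S.
Image : {I : Set} → (I → 𝒫 X) → Pred I 0ℓ → Family X 0ℓ
Image B S A = ∃[ i ] (i ∈ S × A ≐ B i)

∈-Image : {I : Set} (B : I → 𝒫 X) {S : Pred I 0ℓ} {i : I} → i ∈ S → B i ∈ Image B S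
∈-Image B {i = i} i∈ = i , i∈ , (λ x∈ → x∈) , (λ x∈ → x∈)

-- Transporting selective ideals

IsSelectiveIdeal-resp : {𝒥 : Family X ℓ₁} {𝒦 : Family X ℓ₂} → 𝒥 ⊆ 𝒦 → 𝒦 ⊆ 𝒥 →
                        IsSelectiveIdeal 𝒥 → IsSelectiveIdeal 𝒦
IsSelectiveIdeal-resp 𝒥⊆𝒦 𝒦⊆𝒥 sel = record
  { isIdeal = record
    { ∪-closed = λ A∈ B∈ → 𝒥⊆𝒦 (∪-closed (𝒦⊆𝒥 A∈) (𝒦⊆𝒥 B∈))
    ; ⊆-closed = λ B⊆A A∈ → 𝒥⊆𝒦 (⊆-closed B⊆A (𝒦⊆𝒥 A∈))
    ; finite   = λ fin → 𝒥⊆𝒦 (finite fin)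
    ; proper   = λ U∈ → proper (𝒦⊆𝒥 U∈)
    }
  ; selective = λ A A⁺ dec →
      let B , B⁺ , sel-B = selective A (λ n → A⁺ n ∘ 𝒥⊆𝒦) dec
      in B , B⁺ ∘ 𝒦⊆𝒥 , sel-B
  }
  where
  open IsSelectiveIdeal sel
  open IsIdeal isIdeal

-- The Katetov image of an ideal under g.  The image of a positive selector for
-- the preimages of a decreasing sequence is a positive selector for the sequence.
pushforward-selective : {𝒥 : Family X ℓ} (g : X → X) → (∀ {A} → Finite A → (g ⊢ A) ∈ 𝒥) →
                        IsSelectiveIdeal 𝒥 → IsSelectiveIdeal (λ A → (g ⊢ A) ∈ 𝒥)
pushforward-selective {𝒥 = 𝒥} g fin sel = record
  { isIdeal = record
    { ∪-closed = ∪-closed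
    ; ⊆-closed = λ B⊆A → ⊆-closed B⊆A
    ; finite   = fin
    ; proper   = proper
    }
  ; selective = λ A A⁺ dec →
      let B , B⁺ , B⊆A₀ , thin = selective (λ n → g ⊢ A n) A⁺ (λ n → dec n)
      in (λ y → ∃[ x ] (x ∈ B × g x ≡ y))
       , (λ gB∈ → B⁺ (⊆-closed (λ {x} x∈B → x , x∈B , refl) gB∈))
       , (λ { (x , x∈B , refl) → B⊆A₀ x∈B })
       , (λ n → let xs , len , cover = thin n in
            map g xs , subst (_≤ 1) (sym (length-map g xs)) len
          , λ { ((x , x∈B , refl) , in-layer) → ∈-map⁺ g (cover (x∈B , in-layer)) })
  }
  where
  open IsSelectiveIdeal sel
  open IsIdeal isIdeal

-- The same family as 𝒰 * when 𝒰 is closed under supersets, but placed at the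
-- universe level of 𝒰.
dual : Family X ℓ → Family X ℓ
dual 𝒰 B = ∁ B ∈ 𝒰

-- Ideals in classical logic

module Classical (em : ExcludedMiddle (lsuc 0ℓ)) where

  em₀ : ExcludedMiddle 0ℓ
  em₀ {P} with em {Lift (lsuc 0ℓ) P}
  ... | yes p = yes (lower p)
  ... | no ¬p = no λ p → ¬p (lift p)

  by-contradiction : {P : Set₁} → ¬ ¬ P → P
  by-contradiction = decidable-stable em

  by-contradiction₀ : {P : Set} → ¬ ¬ P → P
  by-contradiction₀ = decidable-stable em₀

  split : (A B : 𝒫 X) → A ⊆ (A ∩ B) ∪ (A ∖ B)
  split A B {x} x∈A with em₀ {x ∈ B}
  ... | yes x∈B = inj₁ (x∈A , x∈B)
  ... | no  x∉B = inj₂ (x∈A , x∉B)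

  ⊆*-trans : {A B C : 𝒫 X} → A ⊆* B → B ⊆* C → A ⊆* C
  ⊆*-trans {A = A} {B} {C} A⊆*B B⊆*C = Finite-⊆ cover (Finite-∪ A⊆*B B⊆*C)
    where
    cover : A ∖ C ⊆ (A ∖ B) ∪ (B ∖ C)
    cover {x} (x∈A , x∉C) with em₀ {x ∈ B}
    ... | yes x∈B = inj₂ (x∈B , x∉C)
    ... | no  x∉B = inj₁ (x∈A , x∉B)

  -- A selector is a pseudo-intersection of the sequence: B ∖ A n is contained in the
  -- union of n layers, each of which meets B in at most one point.
  selector-⊆* : {A : ℕ → 𝒫 X} {B : 𝒫 X} → IsSelector A B → ∀ n → B ⊆* A n
  selector-⊆* (B⊆A₀ , thin) zero = ⊆⇒⊆* B⊆A₀
  selector-⊆* {A = A} {B} sel@(_ , thin) (suc n) =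
    Finite-⊆ cover (Finite-∪ (selector-⊆* {A = A} sel n) (∣∣≤⇒Finite (thin n)))
    where
    cover : B ∖ A (suc n) ⊆ (B ∖ A n) ∪ (B ∩ (A n ∖ A (suc n)))
    cover {x} (x∈B , x∉) with em₀ {x ∈ A n}
    ... | yes x∈An = inj₂ (x∈B , x∈An , x∉)
    ... | no  x∉An = inj₁ (x∈B , x∉An)

  module Ideal {𝒥 : Family X ℓ} (ideal : IsIdeal 𝒥) where
    open IsIdeal ideal public

    ∖-positive : {A B : 𝒫 X} → A ∈ 𝒥 ⁺ → A ∩ B ∈ 𝒥 → A ∖ B ∈ 𝒥 ⁺
    ∖-positive {A} {B} A⁺ A∩B∈ A∖B∈ = A⁺ (⊆-closed (split A B) (∪-closed A∩B∈ A∖B∈))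

    ⊆*-closed : {A B : 𝒫 X} → A ⊆* B → B ∈ 𝒥 → A ∈ 𝒥
    ⊆*-closed {A} {B} A⊆*B B∈ =
      ⊆-closed (split A B) (∪-closed (⊆-closed proj₂ B∈) (finite A⊆*B))

  image-countable : {I : Set} (B : I → 𝒫 X) (S : Pred I 0ℓ) → Countable (setoid I) S →
                    Countable (≐-setoid X 0ℓ) (Image B S)
  image-countable {X} {I} B S (code , code-inj) = code′ , inj
    where
    code′ : 𝒫 X → ℕ
    code′ A with em₀ {A ∈ Image B S}
    ... | yes (i , _) = code i
    ... | no  _       = 0

    inj : ∀ {A A′} → A ∈ Image B S → A′ ∈ Image B S → code′ A ≡ code′ A′ → A ≐ A′
    inj {A} {A′} A∈ A′∈ eq with em₀ {A ∈ Image B S} | em₀ {A′ ∈ Image B S}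
    ... | no  A∉ | _      = ⊥-elim (A∉ A∈)
    ... | yes _  | no A′∉ = ⊥-elim (A′∉ A′∈)
    ... | yes (i , i∈ , A⊆ , ⊆A) | yes (j , j∈ , A′⊆ , ⊆A′) with refl ← code-inj i∈ j∈ eq =
      (λ x∈ → ⊆A′ (A⊆ x∈)) , (λ x∈ → ⊆A (A′⊆ x∈))

  ⟨⟩-isIdeal : {𝒥 : Family ℕ ℓ} {𝒜 : Family ℕ 0ℓ} → IsIdeal 𝒥 → U ∉ 𝒥 ⟨ 𝒜 ⟩ →
               IsIdeal (𝒥 ⟨ 𝒜 ⟩)
  ⟨⟩-isIdeal {𝒥 = 𝒥} {𝒜} ideal U∉ = record
    { ∪-closed = λ {A} {B} (F , F⊆ , A∖F∈) (G , G⊆ , B∖G∈) →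
        F ++ G , All-++⁺ F⊆ G⊆ , ⊆-closed
          (λ { (inj₁ x∈A , x∉) → inj₁ (x∈A , x∉ ∘ ⋃-++ˡ F G)
             ; (inj₂ x∈B , x∉) → inj₂ (x∈B , x∉ ∘ ⋃-++ʳ F G) })
          (∪-closed A∖F∈ B∖G∈)
    ; ⊆-closed = λ B⊆A (F , F⊆ , A∖F∈) →
        F , F⊆ , ⊆-closed (λ (x∈B , x∉F) → B⊆A x∈B , x∉F) A∖F∈
    ; finite = λ fin → [] , [] , ⊆-closed proj₁ (finite fin)
    ; proper = U∉
    }
    where
    open IsIdeal ideal

    ⋃-++ˡ : ∀ F G → ⋃ᴸ F ⊆ ⋃ᴸ (F ++ G)
    ⋃-++ˡ (A ∷ F) G (inj₁ x∈A) = inj₁ x∈A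
    ⋃-++ˡ (A ∷ F) G (inj₂ x∈F) = inj₂ (⋃-++ˡ F G x∈F)

    ⋃-++ʳ : ∀ F G → ⋃ᴸ G ⊆ ⋃ᴸ (F ++ G)
    ⋃-++ʳ []      G x∈G = x∈G
    ⋃-++ʳ (A ∷ F) G x∈G = inj₂ (⋃-++ʳ F G x∈G)

  ⊆⟨⟩ : {𝒥 : Family ℕ ℓ} {𝒜 : Family ℕ 0ℓ} → IsIdeal 𝒥 → 𝒥 ⊆ 𝒥 ⟨ 𝒜 ⟩
  ⊆⟨⟩ ideal A∈ = [] , [] , IsIdeal.⊆-closed ideal proj₁ A∈

  generator∈⟨⟩ : {𝒥 : Family ℕ ℓ} {𝒜 : Family ℕ 0ℓ} → IsIdeal 𝒥 → 𝒜 ⊆ 𝒥 ⟨ 𝒜 ⟩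
  generator∈⟨⟩ ideal {A} A∈ =
    A ∷ [] , A∈ ∷ [] , IsIdeal.finite ideal (Finite-∅ λ (x∈A , x∉) → x∉ (inj₁ x∈A))

  -- Adding the complements of a chain of positive sets, ordered by almost
  -- inclusion, leaves an ideal proper.
  chain-proper : {𝒥 : Family ℕ ℓ} → IsIdeal 𝒥 → {I : Set} (B : I → 𝒫 ℕ) (S : Pred I 0ℓ) →
                 (∀ {i} → i ∈ S → B i ∈ 𝒥 ⁺) →
                 (∀ {i j} → i ∈ S → j ∈ S → B i ⊆* B j ⊎ B j ⊆* B i) →
                 U ∉ 𝒥 ⟨ Image (∁ ∘ B) S ⟩
  chain-proper {𝒥 = 𝒥} ideal {I} B S B⁺ chain (F , F⊆ , U∖F∈) =
    [ (λ fin → proper (⊆-closed (λ _ → split U (⋃ᴸ F) tt)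
        (∪-closed (⊆-closed proj₂ (finite fin)) U∖F∈)))
    , (λ (i , i∈ , fin) → B⁺ i∈ (⊆-closed (split (B i) (⋃ᴸ F))
        (∪-closed (finite fin) (⊆-closed (λ (_ , x∉) → tt , x∉) U∖F∈))))
    ]′ (bound F⊆)
    where
    open Ideal ideal

    bound : ∀ {F} → All (_∈ Image (∁ ∘ B) S) F →
            Finite (⋃ᴸ F) ⊎ ∃[ i ] (i ∈ S × Finite (B i ∩ ⋃ᴸ F))
    bound [] = inj₁ (Finite-∅ λ ())
    bound {A ∷ F} ((i , i∈ , A⊆ , _) ∷ F⊆) with bound F⊆
    ... | inj₁ fin = inj₂ (i , i∈ , Finite-⊆
            (λ { (x∈B , inj₁ x∈A) → ⊥-elim (A⊆ x∈A x∈B) ; (_ , inj₂ x∈F) → x∈F }) fin)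
    ... | inj₂ (j , j∈ , fin) with chain i∈ j∈
    ...   | inj₂ Bj⊆*Bi = inj₂ (j , j∈ , Finite-⊆
              (λ { (x∈B , inj₁ x∈A) → inj₁ (x∈B , A⊆ x∈A)
                 ; (x∈B , inj₂ x∈F) → inj₂ (x∈B , x∈F) })
              (Finite-∪ Bj⊆*Bi fin))
    ...   | inj₁ Bi⊆*Bj = inj₂ (i , i∈ , Finite-⊆ cover (Finite-∪ Bi⊆*Bj fin))
      where
      cover : B i ∩ ⋃ᴸ (A ∷ F) ⊆ (B i ∖ B j) ∪ (B j ∩ ⋃ᴸ F)
      cover (x∈B , inj₁ x∈A) = ⊥-elim (A⊆ x∈A x∈B)
      cover {x} (x∈B , inj₂ x∈F) with em₀ {x ∈ B j}
      ... | yes x∈Bj = inj₂ (x∈Bj , x∈F)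
      ... | no  x∉Bj = inj₁ (x∈B , x∉Bj)

  -- Selective ideals and countably generated extensions

  -- For selective 𝒦 and countable 𝒜, some 𝒦-positive set is almost disjoint from
  -- every member of 𝒜: diagonalise the complements of the finite unions.
  almost-disjoint : {𝒦 : Family ℕ 0ℓ} → IsSelectiveIdeal 𝒦 → {𝒜 : Family ℕ 0ℓ} →
                    Countable (≐-setoid ℕ 0ℓ) 𝒜 → U ∉ 𝒦 ⟨ 𝒜 ⟩ →
                    ∃[ B ] (B ∈ 𝒦 ⁺ × (∀ {A} → A ∈ 𝒜 → Finite (B ∩ A)))
  almost-disjoint {𝒦} sel {𝒜} (code , code-inj) U∉ =
    let B , B⁺ , selector = selective D D⁺ (λ n → proj₁)
    in B , B⁺ , λ {A} A∈ → Finite-⊆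
         (λ (x∈B , x∈A) → x∈B , λ (_ , x∉E) → x∉E (E-code A∈ x∈A))
         (selector-⊆* {A = D} selector (suc (code A)))
    where
    open IsSelectiveIdeal sel
    open IsIdeal isIdeal

    -- The member of 𝒜 with code n, or ∅ if there is none.
    E : ℕ → 𝒫 ℕ
    E n with em {∃[ A ] (A ∈ 𝒜 × code A ≡ n)}
    ... | yes (A , _) = A
    ... | no  _       = ∅

    E-code : ∀ {A} → A ∈ 𝒜 → A ⊆ E (code A)
    E-code {A} A∈ x∈A with em {∃[ A′ ] (A′ ∈ 𝒜 × code A′ ≡ code A)}
    ... | yes (A′ , A′∈ , eq) = proj₂ (code-inj A′∈ A∈ eq) x∈A
    ... | no  none            = ⊥-elim (none (A , A∈ , refl))

    -- The complement of the union of the members of 𝒜 with code below n.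
    D : ℕ → 𝒫 ℕ
    D zero    = U
    D (suc n) = D n ∖ E n

    D-cofinal : ∀ n → ∃[ F ] (All (_∈ 𝒜) F × U ∖ ⋃ᴸ F ⊆ D n)
    D-cofinal zero = [] , [] , λ _ → tt
    D-cofinal (suc n) with D-cofinal n | em {∃[ A ] (A ∈ 𝒜 × code A ≡ n)}
    ... | F , F⊆ , ⊆D | yes (A , A∈ , _) =
      A ∷ F , A∈ ∷ F⊆ , λ (_ , x∉) → ⊆D (tt , x∉ ∘ inj₂) , x∉ ∘ inj₁
    ... | F , F⊆ , ⊆D | no _ = F , F⊆ , λ x∈ → ⊆D x∈ , λ ()

    D⁺ : ∀ n → D n ∈ 𝒦 ⁺
    D⁺ n Dn∈ = let F , F⊆ , ⊆D = D-cofinal n in U∉ (F , F⊆ , ⊆-closed ⊆D Dn∈)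

  -- Selectivity in terms of ED

  module _ (β : (ℕ × ℕ) ↔ ℕ) where

    pair : ℕ × ℕ → ℕ
    pair = Inverse.to β

    column row : ℕ → ℕ
    column = proj₁ ∘ Inverse.from β
    row    = proj₂ ∘ Inverse.from β

    unpair-pair : ∀ p → Inverse.from β (pair p) ≡ p
    unpair-pair = Inverse.strictlyInverseʳ β

    column-pair : ∀ n k → column (pair (n , k)) ≡ n
    column-pair n k = cong proj₁ (unpair-pair (n , k))

    row-pair : ∀ n k → row (pair (n , k)) ≡ k
    row-pair n k = cong proj₂ (unpair-pair (n , k))

    columns∈ED : ∀ n → (λ y → column y < n) ∈ ED β
    columns∈ED n = 1 , upTo n , λ {j} → outside {j}
      where
      outside : ∀ {j} → ¬ (∣ (λ k → column (pair (j , k)) < n) ∣< 1) → j ∈ᴸ upTo n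
      outside {j} large with j <? n
      ... | yes j<n = ∈-upTo⁺ j<n
      ... | no  j≮n = ⊥-elim (large ([] , s≤s z≤n , λ {k} c<n →
                        ⊥-elim (j≮n (subst (_< n) (column-pair j k) c<n))))

    -- No f puts ED below the restriction of a selective ideal to a positive set B:
    -- the image under f of a selector for the columns of f in B is in ED.
    selective⇒¬≤ED : {𝒦 : Family ℕ 0ℓ} → IsSelectiveIdeal 𝒦 → {B : 𝒫 ℕ} → B ∈ 𝒦 ⁺ →
                     (f : ℕ → ℕ) → ¬ (∀ C → C ∈ ED β → B ∩ (f ⊢ C) ∈ 𝒦)
    selective⇒¬≤ED {𝒦} sel {B} B⁺ f f-ED =
      let C , C⁺ , C⊆Y₀ , thin = selective Y Y⁺ λ n (x∈B , c≮) → x∈B , λ c<n → c≮ (m≤n⇒m≤1+n c<n)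
      in C⁺ (⊆-closed (λ {x} x∈C → proj₁ (C⊆Y₀ x∈C) , x , x∈C , refl)
           (f-ED (λ y → ∃[ x ] (x ∈ C × f x ≡ y))
             -- Each column of the image has at most one point, so fewer than two.
             (2 , [] , λ {j} large → ⊥-elim (large
               (let xs , len , cover = thin j in
                 map (row ∘ f) xs
               , s≤s (subst (_≤ 1) (sym (length-map (row ∘ f) xs)) len)
               , λ {k} (x , x∈C , fx≡) → let c≡j = trans (cong column fx≡) (column-pair j k) in
                   subst (_∈ᴸ map (row ∘ f) xs) (trans (cong row fx≡) (row-pair j k))
                     (∈-map⁺ (row ∘ f) (cover
                       ( x∈C
                       , (proj₁ (C⊆Y₀ x∈C) , λ c<j → <⇒≱ c<j (≤-reflexive (sym c≡j)))
                       , λ (_ , c≮) → c≮ (s≤s (≤-reflexive c≡j))))))))))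
      where
      open IsSelectiveIdeal sel
      open Ideal isIdeal

      -- The part of B that f maps to column n or beyond; its n-th layer is the
      -- part that f maps to column n.
      Y : ℕ → 𝒫 ℕ
      Y n = B ∖ (λ x → column (f x) < n)

      Y⁺ : ∀ n → Y n ∈ 𝒦 ⁺
      Y⁺ n = ∖-positive B⁺ (f-ED (λ y → column y < n) (columns∈ED n))

    -- Below a set almost disjoint from the members of 𝒜, the ideals 𝒦 and 𝒦 ⟨ 𝒜 ⟩
    -- agree, which reduces the claim to the previous lemma.
    selective⇒¬ED≤⟨⟩ : {𝒦 : Family ℕ 0ℓ} → IsSelectiveIdeal 𝒦 → {𝒜 : Family ℕ 0ℓ} →
                       Countable (≐-setoid ℕ 0ℓ) 𝒜 → U ∉ 𝒦 ⟨ 𝒜 ⟩ →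
                       ¬ (ED β ≤[ AllFunctions ] (𝒦 ⟨ 𝒜 ⟩))
    selective⇒¬ED≤⟨⟩ {𝒦} sel {𝒜} countable U∉ (f , _ , f-ED) =
      let B , B⁺ , disjoint = almost-disjoint sel countable U∉
      in selective⇒¬≤ED sel B⁺ f λ C C∈ →
           let F , F⊆ , f⁻C∖F∈ = f-ED C C∈
           in ⊆*-closed
                (Finite-⊆
                  (λ ((x∈B , x∈f⁻C) , x∉) → x∈B , by-contradiction₀ λ x∉F → x∉ (x∈f⁻C , x∉F))
                  (disjoint-⋃ {B} disjoint F⊆))
                f⁻C∖F∈
      where
      open Ideal (IsSelectiveIdeal.isIdeal sel)

      disjoint-⋃ : ∀ {B F} → (∀ {A} → A ∈ 𝒜 → Finite (B ∩ A)) →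
                   All (_∈ 𝒜) F → Finite (B ∩ ⋃ᴸ F)
      disjoint-⋃ disjoint []        = Finite-∅ λ ()
      disjoint-⋃ disjoint (A∈ ∷ F⊆) = Finite-⊆
        (λ { (x∈B , inj₁ x∈A) → inj₁ (x∈B , x∈A) ; (x∈B , inj₂ x∈F) → inj₂ (x∈B , x∈F) })
        (Finite-∪ (disjoint A∈) (disjoint-⋃ disjoint F⊆))

    -- The converse.  If A has no positive selector, the complements of the A n form
    -- a countable family whose addition to 𝒥 puts ED below it.
    ¬ED≤⟨⟩⇒selective : {𝒥 : Family ℕ 0ℓ} → IsIdeal 𝒥 →
      (∀ {𝒜} → Countable (≐-setoid ℕ 0ℓ) 𝒜 → U ∉ 𝒥 ⟨ 𝒜 ⟩ →
        ¬ (ED β ≤[ AllFunctions ] (𝒥 ⟨ 𝒜 ⟩))) →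
      IsSelectiveIdeal 𝒥
    ¬ED≤⟨⟩⇒selective {𝒥} ideal ¬ED≤ = record
      { isIdeal   = ideal
      ; selective = λ A A⁺ dec → by-contradiction λ none →
          let open Diagonal A A⁺ dec none in
          ¬ED≤ 𝒜-countable U∉𝒦 (f , tt , λ C → f⁻ED∈𝒦 {C})
      }
      where
      module 𝒥 = Ideal ideal

      module Diagonal (A : ℕ → 𝒫 ℕ) (A⁺ : ∀ n → A n ∈ 𝒥 ⁺) (dec : Decreasing A)
                      (none : ¬ (∃[ B ] (B ∈ 𝒥 ⁺ × IsSelector A B))) where

        𝒜 : Family ℕ 0ℓ
        𝒜 = Image (∁ ∘ A) U

        𝒜-countable : Countable (≐-setoid ℕ 0ℓ) 𝒜
        𝒜-countable = image-countable (∁ ∘ A) U (id , λ _ _ → id)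

        chain : ∀ {m n} → A m ⊆* A n ⊎ A n ⊆* A m
        chain {m} {n} with ≤-total m n
        ... | inj₁ m≤n = inj₂ (⊆⇒⊆* (Decreasing⇒antitone {A = A} dec m≤n))
        ... | inj₂ n≤m = inj₁ (⊆⇒⊆* (Decreasing⇒antitone {A = A} dec n≤m))

        U∉𝒦 : U ∉ 𝒥 ⟨ 𝒜 ⟩
        U∉𝒦 = chain-proper ideal A U (λ {n} _ → A⁺ n) (λ {m} {n} _ _ → chain {m} {n})

        module 𝒦 = Ideal (⟨⟩-isIdeal ideal U∉𝒦)

        selector∈𝒥 : ∀ {B} → IsSelector A B → B ∈ 𝒥
        selector∈𝒥 {B} sel with em₀ {B ∈ 𝒥}
        ... | yes B∈ = B∈
        ... | no B⁺  = ⊥-elim (none (B , B⁺ , sel))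

        -- The intersection meets no layer, so it is a selector.
        ⋂A∈𝒥 : (λ x → ∀ n → x ∈ A n) ∈ 𝒥
        ⋂A∈𝒥 = selector∈𝒥 ((λ x∈ → x∈ 0) ,
          λ n → [] , z≤n , λ (x∈ , _ , x∉) → ⊥-elim (x∉ (x∈ (suc n))))

        -- One more than the index of the layer of x, or 0 if x lies in no layer.
        level : ℕ → ℕ
        level x with em₀ {∃[ n ] (x ∈ A n ∖ A (suc n))}
        ... | yes (n , _) = suc n
        ... | no  _       = 0

        level-layer : ∀ {x n} → x ∈ A n ∖ A (suc n) → level x ≡ suc n
        level-layer {x} {n} x∈ with em₀ {∃[ n ] (x ∈ A n ∖ A (suc n))}
        ... | yes (m , x∈m) = cong suc (layer-unique {A = A} dec x∈m x∈)
        ... | no  none′     = ⊥-elim (none′ (n , x∈))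

        layer-level : ∀ {x n} → level x ≡ suc n → x ∈ A n ∖ A (suc n)
        layer-level {x} eq with em₀ {∃[ n ] (x ∈ A n ∖ A (suc n))} | eq
        ... | yes (m , x∈m) | refl = x∈m

        level-zero : ∀ {x} → level x ≡ 0 → x ∈ A 0 → ∀ n → x ∈ A n
        level-zero eq x∈ zero    = x∈
        level-zero {x} eq x∈ (suc n) = by-contradiction₀ λ x∉ →
          0≢1+n (trans (sym eq) (level-layer (level-zero eq x∈ n , x∉)))

        level-fibre∈𝒦 : ∀ n → (λ x → level x ≡ n) ∈ 𝒥 ⟨ 𝒜 ⟩
        level-fibre∈𝒦 zero = 𝒦.⊆-closed cover
            (𝒦.∪-closed (generator∈⟨⟩ ideal (∈-Image (∁ ∘ A) tt)) (⊆⟨⟩ ideal ⋂A∈𝒥))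
          where
          cover : (λ x → level x ≡ 0) ⊆ ∁ (A 0) ∪ (λ x → ∀ n → x ∈ A n)
          cover {x} eq with em₀ {x ∈ A 0}
          ... | yes x∈ = inj₂ (level-zero eq x∈)
          ... | no  x∉ = inj₁ x∉
        level-fibre∈𝒦 (suc n) = 𝒦.⊆-closed
          (λ eq → proj₂ (layer-level eq)) (generator∈⟨⟩ ideal (∈-Image (∁ ∘ A) tt))

        level-list∈𝒦 : ∀ ns → (λ x → level x ∈ᴸ ns) ∈ 𝒥 ⟨ 𝒜 ⟩
        level-list∈𝒦 [] = 𝒦.finite (Finite-∅ λ ())
        level-list∈𝒦 (n ∷ ns) = 𝒦.⊆-closed
          (λ { (here eq) → inj₁ eq ; (there x∈) → inj₂ x∈ })
          (𝒦.∪-closed (level-fibre∈𝒦 n) (level-list∈𝒦 ns))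

        -- One point from the list h (suc n) for each layer n.  Level 0, which is not a
        -- layer, is left out.
        take₁-selector : (h : ℕ → List ℕ) →
          IsSelector A (λ x → level x ≢ 0 × x ∈ᴸ take 1 (h (level x)))
        take₁-selector h = ⊆A₀ , λ n →
            take 1 (h (suc n)) , length-take₁ (h (suc n))
          , λ {x} ((_ , x∈) , x∈layer) → subst (λ l → x ∈ᴸ take 1 (h l)) (level-layer x∈layer) x∈
          where
          ⊆A₀ : (λ x → level x ≢ 0 × x ∈ᴸ take 1 (h (level x))) ⊆ A 0
          ⊆A₀ {x} (l≢0 , _) with level x in eq
          ... | zero  = ⊥-elim (l≢0 refl)
          ... | suc n = Decreasing⇒antitone {A = A} dec z≤n (proj₁ (layer-level eq))

          length-take₁ : ∀ (xs : List ℕ) → length (take 1 xs) ≤ 1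
          length-take₁ []       = z≤n
          length-take₁ (_ ∷ xs) = s≤s z≤n

        -- A set with at most m points on each level is, apart from level 0, a union
        -- of m selectors; the lists h name the points.
        bounded∈𝒦 : ∀ m (h : ℕ → List ℕ) → (∀ n → length (h n) ≤ m) →
                    (λ x → x ∈ᴸ h (level x)) ∈ 𝒥 ⟨ 𝒜 ⟩
        bounded∈𝒦 zero h len = 𝒦.finite (Finite-∅ λ {x} → empty (len (level x)))
          where
          empty : ∀ {x : ℕ} {xs} → length xs ≤ 0 → ¬ (x ∈ᴸ xs)
          empty {xs = []} _ ()
        bounded∈𝒦 (suc m) h len = 𝒦.⊆-closed cover
          (𝒦.∪-closed (level-fibre∈𝒦 0)
            (𝒦.∪-closed (⊆⟨⟩ ideal (selector∈𝒥 (take₁-selector h)))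
              (bounded∈𝒦 m (drop 1 ∘ h) (λ n → length-drop₁ (h n) (len n)))))
          where
          length-drop₁ : ∀ (xs : List ℕ) → length xs ≤ suc m → length (drop 1 xs) ≤ m
          length-drop₁ []       _  = z≤n
          length-drop₁ (_ ∷ xs) le = ≤-pred le

          take-drop : ∀ {x} (xs : List ℕ) → x ∈ᴸ xs → x ∈ᴸ take 1 xs ⊎ x ∈ᴸ drop 1 xs
          take-drop (_ ∷ _) (here eq)  = inj₁ (here eq)
          take-drop (_ ∷ _) (there x∈) = inj₂ x∈

          cover : (λ x → x ∈ᴸ h (level x)) ⊆
                  (λ x → level x ≡ 0) ∪ ((λ x → level x ≢ 0 × x ∈ᴸ take 1 (h (level x))) ∪
                                         (λ x → x ∈ᴸ drop 1 (h (level x))))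
          cover {x} x∈ with em₀ {level x ≡ 0} | take-drop (h (level x)) x∈
          ... | yes l≡0 | _       = inj₁ l≡0
          ... | no  _   | inj₂ x∈ = inj₂ (inj₂ x∈)
          ... | no  l≢0 | inj₁ x∈ = inj₂ (inj₁ (l≢0 , x∈))

        -- Levels become columns; the second coordinate keeps f injective, so that
        -- the bound on the columns of C bounds the levels of its preimage.
        f : ℕ → ℕ
        f x = pair (level x , x)

        f⁻ED∈𝒦 : ∀ {C} → C ∈ ED β → (f ⊢ C) ∈ 𝒥 ⟨ 𝒜 ⟩
        f⁻ED∈𝒦 {C} (m , ns , exceptional) = 𝒦.⊆-closed cover
          (𝒦.∪-closed (level-list∈𝒦 ns) (bounded∈𝒦 m section section-length))
          where
          Small : ℕ → Set
          Small n = ∣ (λ k → pair (n , k) ∈ C) ∣< m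

          -- The points of the n-th column of C, or no points if n is exceptional.
          section : ℕ → List ℕ
          section n with em₀ {Small n}
          ... | yes (ks , _) = ks
          ... | no  _        = []

          section-length : ∀ n → length (section n) ≤ m
          section-length n with em₀ {Small n}
          ... | yes (_ , len , _) = <⇒≤ len
          ... | no  _             = z≤n

          cover : f ⊢ C ⊆ (λ x → level x ∈ᴸ ns) ∪ (λ x → x ∈ᴸ section (level x))
          cover {x} fx∈C with em₀ {Small (level x)}
          ... | yes (_ , _ , ⊆ks) = inj₂ (⊆ks fx∈C)
          ... | no  large         = inj₁ (exceptional large)

    extendable⇔¬≼ : (𝒥 : Family ℕ 0ℓ) → IsIdeal 𝒥 → (𝒢 : FunctionClass) → id ∈ 𝒢 →
                    ExtendableToSelective 𝒥 ⇔ (¬ (ED β ≼ω₁[ AllFunctions , 𝒢 ] 𝒥))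
    extendable⇔¬≼ 𝒥 ideal 𝒢 id∈ = mk⇔ to from
      where
      to : ExtendableToSelective 𝒥 → ¬ (ED β ≼ω₁[ AllFunctions , 𝒢 ] 𝒥)
      to (𝒥′ , sel , 𝒥⊆𝒥′) ED≼ =
        let 𝒜 , countable , U∉ , ED≤ =
              ED≼ 𝒥′ (IsSelectiveIdeal.isIdeal sel) (id , id∈ , λ B → 𝒥⊆𝒥′)
        in selective⇒¬ED≤⟨⟩ sel countable U∉ ED≤

      from : ¬ (ED β ≼ω₁[ AllFunctions , 𝒢 ] 𝒥) → ExtendableToSelective 𝒥
      from ¬ED≼ = by-contradiction λ ¬ext → ¬ED≼ λ 𝒥′ ideal′ (g , _ , g-𝒥) →
        by-contradiction λ none → ¬ext
          ( (λ A → (g ⊢ A) ∈ 𝒥′)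
          , pushforward-selective g (λ fin → g-𝒥 _ (IsIdeal.finite ideal fin))
              (¬ED≤⟨⟩⇒selective ideal′ λ {𝒜} countable U∉ ED≤ →
                none (𝒜 , countable , U∉ , ED≤))
          , λ {A} → g-𝒥 A)

  -- Selective ultrafilters give selective ideals

  dual⊆* : {𝒰 : Family ℕ 0ℓ} → dual 𝒰 ⊆ 𝒰 *
  dual⊆* {x = A} ∁A∈ = ∁ A , ∁A∈ , (λ x∈ x∉ → x∉ x∈) , by-contradiction₀

  *⊆dual : {𝒰 : Family ℕ 0ℓ} → (∀ {A B} → A ⊆ B → A ∈ 𝒰 → B ∈ 𝒰) → 𝒰 * ⊆ dual 𝒰
  *⊆dual up {B} (A , A∈ , B⊆ , _) = up (λ x∈A x∈B → B⊆ x∈B x∈A) A∈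

  -- No use of CH: the dual ideal of 𝒰 is pushed forward along the function that
  -- puts 𝒥 below it.
  some-not⇒extendable : (𝒥 : Family ℕ 0ℓ) → IsIdeal 𝒥 → (𝒢 : FunctionClass) →
    SomeSelectiveUltrafilterIsNot (λ 𝒰 → ¬ (𝒥 ≤[ 𝒢 ] (𝒰 *))) → ExtendableToSelective 𝒥
  some-not⇒extendable 𝒥 ideal 𝒢 (𝒰 , (ultrafilter , sel) , ¬¬𝒥≤) with by-contradiction ¬¬𝒥≤
  ... | g , _ , g-𝒥 =
      (λ A → (g ⊢ A) ∈ dual 𝒰)
    , pushforward-selective g (λ fin → g-𝒥′ (IsIdeal.finite ideal fin))
        (IsSelectiveIdeal-resp to-dual dual⊆* sel)
    , g-𝒥′
    where
    up : ∀ {A B} → A ⊆ B → A ∈ 𝒰 → B ∈ 𝒰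
    up = IsUltrafilter.⊆-closed ultrafilter

    to-dual : 𝒰 * ⊆ dual 𝒰
    to-dual = *⊆dual up

    g-𝒥′ : ∀ {A} → A ∈ 𝒥 → (g ⊢ A) ∈ dual 𝒰
    g-𝒥′ A∈ = to-dual (g-𝒥 _ A∈)

  -- The construction under CH

  -- The least element of a nonempty set in a well-order, and a default value for
  -- the empty set.  Unlike an arbitrary choice it depends only on the extension of
  -- the set, which lets it drive a recursion whose step must be extensional.
  module LeastElement {W : Set} {_≺_ : Rel W 0ℓ} (wf : WellFounded _≺_)
                      (compare : Trichotomous _≡_ _≺_) (default : W) where

    Least : Pred W 0ℓ → Pred W 0ℓ
    Least P w = P w × (∀ v → v ≺ w → ¬ P v)

    least-exists : {P : Pred W 0ℓ} → ∃ P → ∃ (Least P)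
    least-exists {P} (w , Pw) = All.wfRec wf 0ℓ (λ w → P w → ∃ (Least P)) search w Pw
      where
      search : ∀ w → WfRec _≺_ (λ w → P w → ∃ (Least P)) w → P w → ∃ (Least P)
      search w below Pw with em₀ {∃[ v ] (v ≺ w × P v)}
      ... | yes (v , v≺w , Pv) = below v≺w Pv
      ... | no  none           = w , Pw , λ v v≺w Pv → none (v , v≺w , Pv)

    least-unique : {P Q : Pred W 0ℓ} → P ≐ Q → ∀ {v w} → Least P v → Least Q w → v ≡ w
    least-unique (P⊆Q , Q⊆P) {v} {w} (Pv , v-min) (Qw , w-min) with compare v w
    ... | tri< v≺w _ _ = ⊥-elim (w-min v v≺w (P⊆Q Pv))
    ... | tri≈ _ v≡w _ = v≡w
    ... | tri> _ _ w≺v = ⊥-elim (v-min w w≺v (Q⊆P Qw))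

    least : Pred W 0ℓ → W
    least P with em₀ {∃ (Least P)}
    ... | yes (w , _) = w
    ... | no  _       = default

    least-∈ : {P : Pred W 0ℓ} → ∃ P → least P ∈ P
    least-∈ {P} nonempty with em₀ {∃ (Least P)}
    ... | yes (_ , Pw , _) = Pw
    ... | no  none         = ⊥-elim (none (least-exists nonempty))

    least-cong : {P Q : Pred W 0ℓ} → P ≐ Q → least P ≡ least Q
    least-cong {P} {Q} P≐Q@(P⊆Q , Q⊆P) with em₀ {∃ (Least P)} | em₀ {∃ (Least Q)}
    ... | yes (_ , v-least)    | yes (_ , w-least)    = least-unique P≐Q v-least w-least
    ... | yes (v , Pv , _)     | no  none             = ⊥-elim (none (least-exists (v , P⊆Q Pv)))
    ... | no  none             | yes (w , Qw , _)     = ⊥-elim (none (least-exists (w , Q⊆P Qw)))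
    ... | no  _                | no  _                = refl

  -- C settles the sequence A if, provided that A is decreasing, either C misses some
  -- A n, so that no ultrafilter containing C contains every term of A, or C is a
  -- selector for A.
  Settles : 𝒫 ℕ → (ℕ → 𝒫 ℕ) → Set
  Settles C A = Decreasing A → (∃[ n ] (∀ {x} → x ∈ C → x ∉ A n)) ⊎ IsSelector A C

  Settles-⊆ : ∀ {C D A A′} → D ⊆ C → (∀ n → A n ≐ A′ n) → Settles C A → Settles D A′
  Settles-⊆ {A = A} {A′} D⊆C A≐A′ settles dec
    with settles (λ n x∈ → proj₂ (A≐A′ n) (dec n (proj₁ (A≐A′ (suc n)) x∈)))
  ... | inj₁ (n , disjoint) = inj₁ (n , λ x∈D x∈A′ → disjoint (D⊆C x∈D) (proj₂ (A≐A′ n) x∈A′))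
  ... | inj₂ (C⊆A₀ , thin)  = inj₂
    ( (λ x∈D → proj₁ (A≐A′ 0) (C⊆A₀ (D⊆C x∈D)))
    , λ n → let xs , len , cover = thin n in xs , len , λ (x∈D , x∈ , x∉) →
        cover (D⊆C x∈D , proj₂ (A≐A′ n) x∈ , λ x∈A → x∉ (proj₁ (A≐A′ (suc n)) x∈A)))

  module SelectiveIdeal {𝒦 : Family ℕ 0ℓ} (sel : IsSelectiveIdeal 𝒦) where
    open IsSelectiveIdeal sel public using (isIdeal; selective)
    open Ideal isIdeal public

    -- If every A n is positive within B, selectivity applies to the traces B ∩ A n;
    -- otherwise B minus a term of A is still positive.
    settling : ∀ {B} → B ∈ 𝒦 ⁺ → (A : ℕ → 𝒫 ℕ) → ∃[ C ] (C ∈ 𝒦 ⁺ × C ⊆ B × Settles C A)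
    settling {B} B⁺ A with em₀ {Decreasing A}
    ... | no ¬dec = B , B⁺ , id , λ dec → ⊥-elim (¬dec dec)
    ... | yes dec with em₀ {∃[ n ] (B ∩ A n ∈ 𝒦)}
    ...   | yes (n , B∩An∈) = B ∖ A n , ∖-positive B⁺ B∩An∈ , proj₁ , λ _ → inj₁ (n , proj₂)
    ...   | no positive =
      let C , C⁺ , C⊆ , thin = selective (λ n → B ∩ A n) (λ n B∩An∈ → positive (n , B∩An∈))
                                 (λ n (x∈B , x∈A) → x∈B , dec n x∈A)
      in C , C⁺ , (λ x∈C → proj₁ (C⊆ x∈C)) , λ _ → inj₂
           ( (λ x∈C → proj₂ (C⊆ x∈C))
           , λ n → let xs , len , cover = thin n in xs , len , λ (x∈C , x∈ , x∉) →
               cover (x∈C , (proj₁ (C⊆ x∈C) , x∈) , λ (_ , x∈′) → x∉ x∈′))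

    -- A set almost disjoint from the complements of the B i.
    pseudo-intersection : {I : Set} (B : I → 𝒫 ℕ) (S : Pred I 0ℓ) → Countable (setoid I) S →
      (∀ {i} → i ∈ S → B i ∈ 𝒦 ⁺) →
      (∀ {i j} → i ∈ S → j ∈ S → B i ⊆* B j ⊎ B j ⊆* B i) →
      ∃[ C ] (C ∈ 𝒦 ⁺ × (∀ {i} → i ∈ S → C ⊆* B i))
    pseudo-intersection B S countable B⁺ chain =
      let C , C⁺ , disjoint = almost-disjoint sel (image-countable (∁ ∘ B) S countable)
                                (chain-proper isIdeal B S B⁺ chain)
      in C , C⁺ , λ i∈ → disjoint (∈-Image (∁ ∘ B) i∈)

  -- ⟦ w ⟧ enumerates the subsets of ℕ in type ω₁.  Each w also codes a sequence of
  -- sets, and stage α of the construction settles the sequence coded by α.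
  module UnderCH (β : (ℕ × ℕ) ↔ ℕ) {𝒦 : Family ℕ 0ℓ} (sel : IsSelectiveIdeal 𝒦)
                 {W : Set} {_≺_ : Rel W 0ℓ} (isOmega₁ : IsOmega₁ _≺_)
                 (bijection : Bijection (setoid W) (≐-setoid ℕ 0ℓ)) where
    open SelectiveIdeal sel
    open IsOmega₁ isOmega₁
    open IsStrictTotalOrder isStrictTotalOrder using (compare)

    ⟦_⟧ : W → 𝒫 ℕ
    ⟦_⟧ = Bijection.to bijection

    index : (A : 𝒫 ℕ) → ∃[ w ] (⟦ w ⟧ ≐ A)
    index = Bijection.strictlySurjective bijection

    open LeastElement wellFounded compare (proj₁ (index ∅))

    -- The sections of ⟦ w ⟧, regarded as a set of pairs.
    sequence : W → ℕ → 𝒫 ℕ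
    sequence w n k = ⟦ w ⟧ (pair β (n , k))

    sequence-index : (A : ℕ → 𝒫 ℕ) → ∃[ w ] (∀ n → sequence w n ≐ A n)
    sequence-index A =
      let w , w⊆ , ⊆w = index (λ y → A (column β y) (row β y))
      in w , λ n → (λ {k} x∈ → to n k (w⊆ x∈)) , (λ {k} x∈ → ⊆w (from n k x∈))
      where
      to : ∀ n k → A (column β (pair β (n , k))) (row β (pair β (n , k))) → A n k
      to n k = subst (λ p → A (proj₁ p) (proj₂ p)) (unpair-pair β (n , k))

      from : ∀ n k → A n k → A (column β (pair β (n , k))) (row β (pair β (n , k)))
      from n k = subst (λ p → A (proj₁ p) (proj₂ p)) (sym (unpair-pair β (n , k)))

    -- The requirements on the set chosen at stage α, given the earlier choices b.
    Suitable : (α : W) → WfRec _≺_ (λ _ → W) α → Pred W 0ℓ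
    Suitable α b w =
      ⟦ w ⟧ ∈ 𝒦 ⁺ × (∀ γ (γ≺α : γ ≺ α) → ⟦ w ⟧ ⊆* ⟦ b γ≺α ⟧) × Settles ⟦ w ⟧ (sequence α)

    Suitable-resp : ∀ {α} {b b′ : WfRec _≺_ (λ _ → W) α} →
                    (∀ {γ} (γ≺α : γ ≺ α) → b γ≺α ≡ b′ γ≺α) → Suitable α b ⊆ Suitable α b′
    Suitable-resp b≡b′ {w} (positive , below , settles) =
      positive , (λ γ γ≺α → subst (λ v → ⟦ w ⟧ ⊆* ⟦ v ⟧) (b≡b′ γ≺α) (below γ γ≺α)) , settles

    step : (α : W) → WfRec _≺_ (λ _ → W) α → W
    step α b = least (Suitable α b)

    step-ext : ∀ α {b b′ : WfRec _≺_ (λ _ → W) α} →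
               (∀ {γ} (γ≺α : γ ≺ α) → b γ≺α ≡ b′ γ≺α) → step α b ≡ step α b′
    step-ext α b≡b′ = least-cong (Suitable-resp b≡b′ , Suitable-resp (λ γ≺α → sym (b≡b′ γ≺α)))

    -- The recursion is opaque: only choice-suitable is used below, and unfolding
    -- the well-founded recursion during type checking is costly.
    abstract
      choice : W → W
      choice = All.wfRec wellFounded 0ℓ (λ _ → W) step

      -- Given suitable earlier stages, a pseudo-intersection of the tower so far has
      -- a positive subset settling the sequence of stage α, and this subset is some
      -- ⟦ w ⟧; so the least choice is itself suitable.
      choice-suitable : ∀ α → Suitable α (λ {γ} _ → choice γ) (choice α)
      choice-suitable = All.wfRec wellFounded 0ℓ
        (λ α → Suitable α (λ {γ} _ → choice γ) (choice α)) λ α below →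
          subst (Suitable α (λ {γ} _ → choice γ))
                (sym (FixPoint.unfold-wfRec wellFounded (λ _ → W) step step-ext))
                (least-∈ (exists α below))
        where
        B : W → 𝒫 ℕ
        B α = ⟦ choice α ⟧

        exists : ∀ α → WfRec _≺_ (λ α → Suitable α (λ {γ} _ → choice γ) (choice α)) α →
                 ∃ (Suitable α (λ {γ} _ → choice γ))
        exists α below =
          let C , C⁺ , C⊆*B = pseudo-intersection B (_≺ α) (segmentsCountable α)
                                (λ γ≺α → proj₁ (below γ≺α)) chain
              D , D⁺ , D⊆C , settles = settling C⁺ (sequence α)
              w , w⊆D , D⊆w = index D
          in w , (λ w∈ → D⁺ (⊆-closed D⊆w w∈))
               , (λ γ γ≺α → Finite-⊆ (λ (x∈w , x∉) → D⊆C (w⊆D x∈w) , x∉) (C⊆*B γ≺α))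
               , Settles-⊆ w⊆D (λ n → (λ x∈ → x∈) , (λ x∈ → x∈)) settles
          where
          chain : ∀ {γ δ} → γ ≺ α → δ ≺ α → B γ ⊆* B δ ⊎ B δ ⊆* B γ
          chain {γ} {δ} γ≺α δ≺α with compare γ δ
          ... | tri< γ≺δ _ _  = inj₂ (proj₁ (proj₂ (below δ≺α)) γ γ≺δ)
          ... | tri≈ _ refl _ = inj₁ (⊆⇒⊆* (λ x∈ → x∈))
          ... | tri> _ _ δ≺γ  = inj₁ (proj₁ (proj₂ (below γ≺α)) δ δ≺γ)

    -- The tower of positive sets, almost decreasing in α.
    B : W → 𝒫 ℕ
    B α = ⟦ choice α ⟧

    B⁺ : ∀ α → B α ∈ 𝒦 ⁺
    B⁺ α = proj₁ (choice-suitable α)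

    B-settles : ∀ α → Settles (B α) (sequence α)
    B-settles α = proj₂ (proj₂ (choice-suitable α))

    B-chain : ∀ α γ → B α ⊆* B γ ⊎ B γ ⊆* B α
    B-chain α γ with compare α γ
    ... | tri< α≺γ _ _  = inj₂ (proj₁ (proj₂ (choice-suitable γ)) α α≺γ)
    ... | tri≈ _ refl _ = inj₁ (⊆⇒⊆* (λ x∈ → x∈))
    ... | tri> _ _ γ≺α  = inj₁ (proj₁ (proj₂ (choice-suitable α)) γ γ≺α)

    -- The filter generated by the tower and the cofinite sets.
    𝒰 : Family ℕ 0ℓ
    𝒰 A = ∃[ α ] (B α ⊆* A)

    𝒰-⊆-closed : ∀ {A C} → A ⊆ C → A ∈ 𝒰 → C ∈ 𝒰
    𝒰-⊆-closed A⊆C (α , fin) = α , Finite-⊆ (λ (x∈ , x∉) → x∈ , x∉ ∘ A⊆C) fin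

    𝒰-∩-closed : ∀ {A C} → A ∈ 𝒰 → C ∈ 𝒰 → A ∩ C ∈ 𝒰
    𝒰-∩-closed {A} {C} (α , α⊆*A) (γ , γ⊆*C) =
      [ (λ α⊆*γ → α , both α⊆*A (⊆*-trans α⊆*γ γ⊆*C))
      , (λ γ⊆*α → γ , both (⊆*-trans γ⊆*α α⊆*A) γ⊆*C)
      ]′ (B-chain α γ)
      where
      both : ∀ {D} → D ⊆* A → D ⊆* C → D ⊆* (A ∩ C)
      both {D} D⊆*A D⊆*C = Finite-⊆ cover (Finite-∪ D⊆*A D⊆*C)
        where
        cover : D ∖ (A ∩ C) ⊆ (D ∖ A) ∪ (D ∖ C)
        cover {x} (x∈D , x∉) with em₀ {x ∈ A}
        ... | yes x∈A = inj₂ (x∈D , λ x∈C → x∉ (x∈A , x∈C))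
        ... | no  x∉A = inj₁ (x∈D , x∉A)

    𝒰⊆𝒦⁺ : ∀ {A} → A ∈ 𝒰 → A ∈ 𝒦 ⁺
    𝒰⊆𝒦⁺ (α , α⊆*A) A∈ = B⁺ α (⊆*-closed α⊆*A A∈)

    -- A constant sequence is decreasing, and settling it decides its value.
    𝒰-ultra : ∀ A → A ∈ 𝒰 ⊎ ∁ A ∈ 𝒰
    𝒰-ultra A with sequence-index (λ _ → A)
    ... | α , seq≐A with Settles-⊆ {A = sequence α} (λ x∈ → x∈) seq≐A (B-settles α) (λ _ x∈ → x∈)
    ...   | inj₁ (_ , disjoint) = inj₂ (α , ⊆⇒⊆* disjoint)
    ...   | inj₂ (B⊆A , _)      = inj₁ (α , ⊆⇒⊆* B⊆A)

    𝒰-isUltrafilter : IsUltrafilter 𝒰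
    𝒰-isUltrafilter = record
      { ∩-closed = 𝒰-∩-closed
      ; ⊆-closed = 𝒰-⊆-closed
      ; proper   = λ ∅∈ → 𝒰⊆𝒦⁺ ∅∈ (finite (Finite-∅ λ ()))
      ; ultra    = 𝒰-ultra
      ; cofinite = λ fin → proj₁ (index ∅) , Finite-⊆ proj₂ fin
      }

    -- The stage that settles A puts a selector for A into 𝒰: it cannot miss a term
    -- of A, as all of them are in 𝒰.
    𝒰-selective : IsSelectiveIdeal (dual 𝒰)
    𝒰-selective = record
      { isIdeal = record
        { ∪-closed = λ ∁A∈ ∁C∈ → 𝒰-⊆-closed
            (λ { (x∉A , _) (inj₁ x∈A) → x∉A x∈A ; (_ , x∉C) (inj₂ x∈C) → x∉C x∈C })
            (𝒰-∩-closed ∁A∈ ∁C∈)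
        ; ⊆-closed = λ C⊆A → 𝒰-⊆-closed (λ x∉A x∈C → x∉A (C⊆A x∈C))
        ; finite   = λ fin → proj₁ (index ∅) ,
            Finite-⊆ (λ (_ , ¬¬x∈) → by-contradiction₀ ¬¬x∈) fin
        ; proper   = λ ∁U∈ → 𝒰⊆𝒦⁺ ∁U∈ (finite (Finite-∅ λ x∉ → x∉ tt))
        }
      ; selective = λ A A⁺ dec → diagonal A (λ n → [ id , ⊥-elim ∘ A⁺ n ]′ (𝒰-ultra (A n))) dec
      }
      where
      disjoint-absurd : ∀ {A C} → A ∈ 𝒰 → C ∈ 𝒰 → ¬ (∀ {x} → x ∈ A → x ∉ C)
      disjoint-absurd A∈ C∈ disjoint = 𝒰⊆𝒦⁺ (𝒰-∩-closed A∈ C∈)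
        (finite (Finite-∅ λ (x∈A , x∈C) → disjoint x∈A x∈C))

      diagonal : ∀ A → (∀ n → A n ∈ 𝒰) → Decreasing A →
                 ∃[ C ] (C ∈ dual 𝒰 ⁺ × IsSelector A C)
      diagonal A A∈ dec with sequence-index A
      ... | α , seq≐A with Settles-⊆ {A = sequence α} (λ x∈ → x∈) seq≐A (B-settles α) dec
      ...   | inj₁ (n , disjoint) =
        ⊥-elim (disjoint-absurd (α , ⊆⇒⊆* (λ x∈ → x∈)) (A∈ n) disjoint)
      ...   | inj₂ selector = B α
            , (λ ∁B∈ → disjoint-absurd (α , ⊆⇒⊆* (λ x∈ → x∈)) ∁B∈ λ x∈ x∉ → x∉ x∈)
            , selector

    𝒦⊆dual : 𝒦 ⊆ dual 𝒰
    𝒦⊆dual {A} A∈ = [ (λ A∈𝒰 → ⊥-elim (𝒰⊆𝒦⁺ A∈𝒰 A∈)) , id ]′ (𝒰-ultra A)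

  selective-ultrafilter : (ℕ × ℕ) ↔ ℕ → CH → {𝒦 : Family ℕ 0ℓ} → IsSelectiveIdeal 𝒦 →
                          Σ[ 𝒰 ∈ Family ℕ 0ℓ ] (IsSelectiveUltrafilter 𝒰 × 𝒦 ⊆ 𝒰 *)
  selective-ultrafilter β (W , _≺_ , isOmega₁ , bijection) sel =
      𝒰
    , (𝒰-isUltrafilter , IsSelectiveIdeal-resp dual⊆* (*⊆dual 𝒰-⊆-closed) 𝒰-selective)
    , λ A∈ → dual⊆* (𝒦⊆dual A∈)
    where
    open UnderCH β sel isOmega₁ bijection

  extendable⇔some-not : (ℕ × ℕ) ↔ ℕ → CH → (𝒥 : Family ℕ 0ℓ) → IsIdeal 𝒥 →
    (𝒢 : FunctionClass) → id ∈ 𝒢 →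
    ExtendableToSelective 𝒥 ⇔ SomeSelectiveUltrafilterIsNot (λ 𝒰 → ¬ (𝒥 ≤[ 𝒢 ] (𝒰 *)))
  extendable⇔some-not β ch 𝒥 ideal 𝒢 id∈ = mk⇔
    (λ (𝒦 , sel , 𝒥⊆𝒦) →
      let 𝒰 , selective , 𝒦⊆𝒰* = selective-ultrafilter β ch sel
      in 𝒰 , selective , λ 𝒥≰ → 𝒥≰ (id , id∈ , λ A A∈ → 𝒦⊆𝒰* (𝒥⊆𝒦 A∈)))
    (some-not⇒extendable 𝒥 ideal 𝒢)

id∈1-1 : id ∈ 1-1
id∈1-1 = id

id∈Fin-1 : id ∈ Fin-1
id∈Fin-1 n = n ∷ [] , λ n≡x → here (sym n≡x)

theorem9p3 : ExcludedMiddle (lsuc 0ℓ) →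
    (β : (ℕ × ℕ) ↔ ℕ) (𝒥 : Family ℕ 0ℓ) → IsIdeal 𝒥 →
    ( (ExtendableToSelective 𝒥 ⇔ (¬ (ED β ≼ω₁[ AllFunctions , 1-1 ] 𝒥)))
    × (ExtendableToSelective 𝒥 ⇔ (¬ (ED β ≼ω₁[ AllFunctions , Fin-1 ] 𝒥)))
    × (ExtendableToSelective 𝒥 ⇔ (¬ (ED β ≼ω₁[ AllFunctions , AllFunctions ] 𝒥))) )
    ×
    ( CH →
    (ExtendableToSelective 𝒥 ⇔ SomeSelectiveUltrafilterIsNot (IsPointFor 𝒥))
    × (ExtendableToSelective 𝒥 ⇔ SomeSelectiveUltrafilterIsNot (IsWeakUltrafilterFor 𝒥))
    × (ExtendableToSelective 𝒥 ⇔ SomeSelectiveUltrafilterIsNot (IsUltrafilterFor 𝒥)) )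
theorem9p3 em β 𝒥 ideal =
    ( extendable⇔¬≼ β 𝒥 ideal 1-1 id∈1-1
    , extendable⇔¬≼ β 𝒥 ideal Fin-1 id∈Fin-1
    , extendable⇔¬≼ β 𝒥 ideal AllFunctions tt )
  , λ ch → extendable⇔some-not β ch 𝒥 ideal 1-1 id∈1-1
         , extendable⇔some-not β ch 𝒥 ideal Fin-1 id∈Fin-1
         , extendable⇔some-not β ch 𝒥 ideal AllFunctions tt
  where open Classical em
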